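{- Let $v\ge 4$ be a multiple of $3$. The hypergraph $K_v^{(3)}-I$ admits a decomposition into tight $6$-cycles if and only if $v\equiv 0,3,6 \pmod{12}$.
   Context: $K_v^{(3)}$ denotes the complete $3$-uniform hypergraph on $v$ vertices (all $3$-element subsets of the vertex set are edges). For $3\mid v$, $K_v^{(3)}-I$ denotes the hypergraph obtained from $K_v^{(3)}$ by deleting the edges of a $1$-factor $I$, i.e. a set of $v/3$ pairwise disjoint triples covering all vertices (the choice of $I$ is irrelevant up to isomorphism). A (3-uniform tight) $k$-cycle is given by a cyclic sequence $v_1,v_2,\dots,v_k$ of $k$ distinct vertices, its edges being the $k$ triples $\{v_i,v_{i+1},v_{i+2}\}$, $i=1,\dots,k$, with indices taken modulo $k$. A decomposition of a hypergraph $\mathcal H$ into $k$-cycles is a collection of $k$-cycles (sub-hypergraphs of $\mathcal H$) whose edge sets partition the edge set of $\mathcal H$. -}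

module Defs where

open import Data.Fin using (Fin; toℕ)
open import Data.Fin.Subset using (Subset; ⁅_⁆; _∪_; _∩_; ∣_∣; Empty; _∈_)
open import Data.List using (List; length)
open import Data.List.Membership.Propositional using () renaming (_∉_ to _∉ₗ_)
open import Data.List.Relation.Unary.All using (All)
open import Data.List.Relation.Unary.AllPairs using (AllPairs)
open import Data.List.Relation.Unary.Any using (Any)
open import Data.Nat using (ℕ; _+_; _/_; NonZero)
open import Data.Nat.DivMod using (_mod_)
open import Data.Product using (_×_; ∃-syntax)
open import Function.Definitions using (Injective)
open import Level using (0ℓ)
open import Relation.Binary.PropositionalEquality using (_≡_)
open import Relation.Unary using (Pred; _⊆_; _⊥_)

-- A hypergraph on the vertex set Fin v is given by its set of edges.
-- Subset v is a vector of booleans, so _≡_ on edges is equality of sets.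
Hypergraph : ℕ → Set₁
Hypergraph v = Pred (Subset v) 0ℓ

K⁽³⁾ : (v : ℕ) → Hypergraph v
K⁽³⁾ v e = ∣ e ∣ ≡ 3

record OneFactor (v : ℕ) : Set where
  field
    triples  : List (Subset v)
    size     : length triples ≡ v / 3
    uniform  : All (λ t → ∣ t ∣ ≡ 3) triples
    disjoint : AllPairs (λ s t → Empty (s ∩ t)) triples
    covers   : (x : Fin v) → Any (x ∈_) triples

K⁽³⁾_-_ : (v : ℕ) → OneFactor v → Hypergraph v
(K⁽³⁾ v - I) e = K⁽³⁾ v e × e ∉ₗ OneFactor.triples I

record Cycle (k v : ℕ) : Set where
  field
    vertex   : Fin k → Fin v
    distinct : Injective _≡_ _≡_ vertex

module _ {k v : ℕ} .{{_ : NonZero k}} where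

  triple : Cycle k v → Fin k → Subset v
  triple C i = ⁅ at 0 ⁆ ∪ ⁅ at 1 ⁆ ∪ ⁅ at 2 ⁆
    where
    at : ℕ → Fin v
    at j = Cycle.vertex C ((toℕ i + j) mod k)

  edges : Cycle k v → Hypergraph v
  edges C e = ∃[ i ] e ≡ triple C i

record Decomposition (k : ℕ) .{{_ : NonZero k}} {v : ℕ} (H : Hypergraph v) : Set where
  field
    cycles   : List (Cycle k v)
    within   : All (λ C → edges C ⊆ H) cycles
    disjoint : AllPairs (λ C D → edges C ⊥ edges D) cycles
    covers   : (e : Subset v) → H e → Any (λ C → edges C e) cycles

{-# OPTIONS --safe #-}
module Submission where

-- Write v = 3m and let the triples of I be m groups. An edge of K − I meets two groups or three.
-- The 18 edges meeting two given groups form K₆ minus a 1-factor, which splits into three 6-cycles.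
-- The 27 transversals of groups A, B, C together with the 27 of A, B, D form K₃,₃,₆, which splits into
-- nine 6-cycles, so it remains to match up the triples of an m-set such that partners share two points.
-- For m ≢ 3 (mod 4) such a matching is built by adding four points at a time.
-- It then suffices to show that every triple is covered: the listed edges and the m triples of I number
-- exactly C(3m,3), so nothing is covered twice.
-- Conversely, six times the number of cycles is C(3m,3) − m = 27·C(m,3) + 18·C(m,2), which is odd
-- for m ≡ 3 (mod 4).

open import Defs
open import Data.Bool.Properties using () renaming (_≟_ to _≟ᵇ_)
open import Data.Fin using (Fin; zero; suc; toℕ; combine; remQuot)
open import Data.Fin.Patterns using (0F; 1F; 2F; 3F)
open import Data.Fin.Properties using (all?; any?; remQuot-combine) renaming (_≟_ to _≟ᶠ_)
open import Data.Fin.Subset using (Subset; inside; outside; ⁅_⁆; _∪_; _∩_; ∣_∣; ⊥; Empty; _∈_; _∉_; _⊆_)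
open import Data.Fin.Subset.Properties using (x∈⁅x⁆; x∈⁅y⁆⇒x≡y; x∈p∪q⁺; x∈p∪q⁻; x∈p∩q⁺; ⊆-antisym; ∪-assoc; ∪-comm; ∪-idem; ∪-identityˡ; ∪-identityʳ; ∣⁅x⁆∣≡1; drop-there)
open import Data.List using (List; []; _∷_; _++_; map; concatMap; allFin; cartesianProduct; length)
open import Data.List.Membership.Propositional using (find; lose) renaming (_∈_ to _∈ₗ_)
open import Data.List.Membership.Propositional.Properties using (∈-∃++; ∈-++⁺ˡ; ∈-++⁺ʳ; ∈-++⁻; ∈-map⁺; ∈-map⁻; ∈-allFin; ∈-concatMap⁺; ∈-concatMap⁻)
open import Data.List.Properties using (length-map; length-++; ++-identityʳ)
open import Data.List.Relation.Binary.Disjoint.Propositional using (Disjoint)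
open import Data.List.Relation.Binary.Permutation.Propositional using (_↭_; prep; ↭-refl; ↭-sym; ↭-trans; ↭⇒↭ₛ)
open import Data.List.Relation.Binary.Permutation.Propositional.Properties using (∈-resp-↭; ↭-length; shift)
import Data.List.Relation.Binary.Permutation.Setoid.Properties as ↭ₛ
open import Data.List.Relation.Unary.All as All using (All; []; _∷_)
import Data.List.Relation.Unary.All.Properties as All
open import Data.List.Relation.Unary.AllPairs as AllPairs using (AllPairs; []; _∷_)
import Data.List.Relation.Unary.AllPairs.Properties as AllPairs
open import Data.List.Relation.Unary.Any as Any using (Any; here; there)
import Data.List.Relation.Unary.Any.Properties as Any
open import Data.List.Relation.Unary.Unique.Propositional using (Unique)
import Data.List.Relation.Unary.Unique.Propositional.Properties as Unique
open import Data.Nat using (ℕ; zero; suc; _+_; _*_; _≤_; _<_; _/_; _%_; z≤n; s≤s)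
open import Data.Nat.DivMod using (_mod_; m%n<n; m*n/n≡m; m≡m%n+[m/n]*n; m%n*o≡m*o%[n*o])
open import Data.Nat.Divisibility using (_∣_; divides)
open import Data.Nat.Properties using (+-cancelˡ-≡; +-cancelʳ-≡; +-monoʳ-≤; +-identityʳ; +-suc; *-zeroʳ; *-suc; ≤-refl; ≤-reflexive; ≤-trans; ≤-antisym; m≤m+n; m≤n⇒m≤1+n; n≮n; suc-injective; even≢odd; module ≤-Reasoning)
open import Data.Nat.Tactic.RingSolver using (solve-∀)
open import Data.Product using (Σ; ∃₂; ∃-syntax; _×_; _,_; proj₁; proj₂; uncurry)
open import Data.Sum using (_⊎_; inj₁; inj₂; [_,_]′)
open import Data.Unit using (⊤; tt)
open import Data.Vec using ([]; _∷_; lookup)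
open import Data.Vec.Properties using (≡-dec)
open import Function using (_∘_; id; case_of_)
open import Function.Bundles using (_⇔_; mk⇔; Equivalence)
open import Function.Definitions using (Injective)
open import Relation.Binary.Definitions using (Symmetric; DecidableEquality)
open import Relation.Binary.PropositionalEquality using (_≡_; _≢_; refl; sym; trans; cong; cong₂; subst; setoid; module ≡-Reasoning)
open import Relation.Nullary using (¬_; Dec; yes; no; contradiction)
open import Relation.Nullary.Decidable using (toWitness; ¬?; _×-dec_; _⊎-dec_; _→-dec_)

variable
  A B : Set
  n k v : ℕ

-- Duplicate-free lists and counting

unique-⊆⇒↭++ : {xs ys : List A} → Unique xs → (∀ {x} → x ∈ₗ xs → x ∈ₗ ys) → ∃[ zs ] ys ↭ xs ++ zs
-- Take `x` out of `ys`. As `x` does not recur in `xs`, the rest of `xs` still lies in `as ++ bs`.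
unique-⊆⇒↭++ {ys = ys} [] xs⊆ys = ys , ↭-refl
unique-⊆⇒↭++ {xs = x ∷ xs} (x∉xs ∷ xs!) x∷xs⊆ys with as , bs , refl ← ∈-∃++ (x∷xs⊆ys (here refl)) =
  let zs , p = unique-⊆⇒↭++ xs! xs⊆as++bs in zs , ↭-trans (shift x as bs) (prep x p)
  where
  xs⊆as++bs : ∀ {z} → z ∈ₗ xs → z ∈ₗ as ++ bs
  xs⊆as++bs z∈xs with ∈-resp-↭ (shift x as bs) (x∷xs⊆ys (there z∈xs))
  ... | here refl = contradiction refl (All.lookup x∉xs z∈xs)
  ... | there z∈  = z∈

unique-⊆⇒length≤ : {xs ys : List A} → Unique xs → (∀ {x} → x ∈ₗ xs → x ∈ₗ ys) → length xs ≤ length ys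
unique-⊆⇒length≤ {xs = xs} xs! xs⊆ys with zs , p ← unique-⊆⇒↭++ xs! xs⊆ys =
  ≤-trans (m≤m+n (length xs) (length zs)) (≤-reflexive (sym (trans (↭-length p) (length-++ xs))))

unique-⊆-length≡⇒↭ : {xs ys : List A} → Unique xs → (∀ {x} → x ∈ₗ xs → x ∈ₗ ys) → length xs ≡ length ys → xs ↭ ys
unique-⊆-length≡⇒↭ {xs = xs} xs! xs⊆ys eq with unique-⊆⇒↭++ xs! xs⊆ys
... | [] , p = ↭-sym (subst (_ ↭_) (++-identityʳ xs) p)
... | z ∷ zs , p = contradiction (+-cancelˡ-≡ (length xs) _ _
  (trans (+-identityʳ _) (trans eq (trans (↭-length p) (length-++ xs))))) λ ()

unique-++⁻ : (xs : List A) {ys : List A} → Unique (xs ++ ys) → Unique xs × Unique ys × Disjoint xs ys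
unique-++⁻ [] ys! = [] , ys! , λ { (() , _) }
unique-++⁻ (x ∷ xs) (x∉ ∷ xs++ys!) with xs! , ys! , xs#ys ← unique-++⁻ xs xs++ys! | x∉xs , x∉ys ← All.++⁻ xs x∉ =
  x∉xs ∷ xs! , ys! , λ { (here refl , z∈ys) → All.lookup x∉ys z∈ys refl
                       ; (there z∈xs , z∈ys) → xs#ys (z∈xs , z∈ys) }

-- Comparing the positions of `a` and `b` in the list yields the case split without deciding
-- equality of elements, which matters for elements such as `Group v` that are functions.
allPairs-lookup : {R : A → A → Set} → Symmetric R → {xs : List A} → AllPairs R xs →
  ∀ {a b} → a ∈ₗ xs → b ∈ₗ xs → a ≡ b ⊎ R a b
allPairs-lookup R-sym (Rx ∷ Rxs) (here refl) (here refl) = inj₁ refl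
allPairs-lookup R-sym (Rx ∷ Rxs) (here refl) (there b∈)  = inj₂ (All.lookup Rx b∈)
allPairs-lookup R-sym (Rx ∷ Rxs) (there a∈)  (here refl) = inj₂ (R-sym (All.lookup Rx a∈))
allPairs-lookup R-sym (Rx ∷ Rxs) (there a∈)  (there b∈)  = allPairs-lookup R-sym Rxs a∈ b∈

unique-map⇒injective : (f : A → B) {xs : List A} → Unique (map f xs) →
  ∀ {a b} → a ∈ₗ xs → b ∈ₗ xs → f a ≡ f b → a ≡ b
unique-map⇒injective f fxs! a∈ b∈ fa≡fb
  with allPairs-lookup (λ fa≢fb → fa≢fb ∘ sym) (AllPairs.map⁻ fxs!) a∈ b∈
... | inj₁ a≡b   = a≡b
... | inj₂ fa≢fb = contradiction fa≡fb fa≢fb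

length-concatMap-const : (f : A → List B) → (∀ x → length (f x) ≡ k) → (xs : List A) → length (concatMap f xs) ≡ k * length xs
length-concatMap-const {k = k} f eq [] = sym (*-zeroʳ k)
length-concatMap-const {k = k} f eq (x ∷ xs) = begin
  length (f x ++ concatMap f xs)          ≡⟨ length-++ (f x) ⟩
  length (f x) + length (concatMap f xs)  ≡⟨ cong₂ _+_ (eq x) (length-concatMap-const f eq xs) ⟩
  k + k * length xs                       ≡⟨ *-suc k (length xs) ⟨
  k * suc (length xs)                     ∎
  where open ≡-Reasoning

-- Binomial coefficients

c₂ : ℕ → ℕ
c₂ zero    = 0
c₂ (suc n) = n + c₂ n

c₃ : ℕ → ℕ
c₃ zero    = 0
c₃ (suc n) = c₂ n + c₃ n

-- For `m` groups of size 3, the term `9 * c₂ m` counts the pairs of vertices from different groups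
-- and `3 * m` those within a group.
c₂-triple : ∀ m → c₂ (m * 3) ≡ 9 * c₂ m + 3 * m
c₂-triple zero    = refl
c₂-triple (suc m) = trans (cong (λ c → 2 + m * 3 + (1 + m * 3 + (m * 3 + c))) (c₂-triple m)) (eq m (c₂ m))
  where
  eq : ∀ m c → 2 + m * 3 + (1 + m * 3 + (m * 3 + (9 * c + 3 * m))) ≡ 9 * (m + c) + 3 * suc m
  eq = solve-∀

-- A triple of vertices meets three, two or one of the m groups of size 3.
c₃-triple : ∀ m → c₃ (m * 3) ≡ 27 * c₃ m + 18 * c₂ m + m
c₃-triple zero    = refl
c₃-triple (suc m) = trans
  (cong₂ (λ c d → 1 + m * 3 + (m * 3 + c) + (m * 3 + c + (c + d))) (c₂-triple m) (c₃-triple m))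
  (eq m (c₂ m) (c₃ m))
  where
  eq : ∀ m c d → 1 + m * 3 + (m * 3 + (9 * c + 3 * m)) + (m * 3 + (9 * c + 3 * m) + (9 * c + 3 * m + (27 * d + 18 * c + m)))
       ≡ 27 * (c + d) + 18 * (m + c) + suc m
  eq = solve-∀

-- Splitting the triples by how many of four new points they contain gives 4·C(n,2) + 6n + 4 +
-- C(n,3). The first three terms are grouped as an even number, for the parity argument and for the
-- pairing of triples in `quads`.
c₃-4+ : ∀ n → c₃ (4 + n) ≡ 2 * (2 * c₂ n + (3 * n + 2)) + c₃ n
c₃-4+ n = eq n (c₂ n) (c₃ n)
  where
  eq : ∀ n c d → 2 + n + (1 + n + (n + c)) + (1 + n + (n + c) + (n + c + (c + d))) ≡ 2 * (2 * c + (3 * n + 2)) + d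
  eq = solve-∀

-- By `c₃-4+`, a step of four changes `c₃` by an even number, and `c₃ 3` is 1.
c₃-odd : ∀ q → ∃[ h ] c₃ (3 + q * 4) ≡ suc (2 * h)
c₃-odd zero    = 0 , refl
c₃-odd (suc q) with h , eq ← c₃-odd q = a + h , (begin
  c₃ (4 + l)           ≡⟨ c₃-4+ l ⟩
  2 * a + c₃ l         ≡⟨ cong (2 * a +_) eq ⟩
  2 * a + suc (2 * h)  ≡⟨ lemma a h ⟩
  suc (2 * (a + h))    ∎)
  where
  open ≡-Reasoning
  l = 3 + q * 4
  a = 2 * c₂ l + (3 * l + 2)
  lemma : ∀ a h → 2 * a + suc (2 * h) ≡ suc (2 * (a + h))
  lemma = solve-∀

-- Subsets of a given size

choose : (n k : ℕ) → List (Subset n)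
choose zero    zero    = [] ∷ []
choose zero    (suc k) = []
choose (suc n) zero    = map (outside ∷_) (choose n zero)
choose (suc n) (suc k) = map (inside ∷_) (choose n k) ++ map (outside ∷_) (choose n (suc k))

choose-complete : (p : Subset n) → p ∈ₗ choose n ∣ p ∣
choose-complete []            = here refl
choose-complete (inside ∷ p)  = ∈-++⁺ˡ (∈-map⁺ _ (choose-complete p))
choose-complete (outside ∷ p) with ∣ p ∣ | choose-complete p
... | zero  | p∈ = ∈-map⁺ _ p∈
... | suc k | p∈ = ∈-++⁺ʳ _ (∈-map⁺ _ p∈)

choose-sound : ∀ n k {p : Subset n} → p ∈ₗ choose n k → ∣ p ∣ ≡ k
choose-sound zero    zero    (here refl) = refl
choose-sound (suc n) zero    p∈ with q , q∈ , refl ← ∈-map⁻ _ p∈ = choose-sound n zero q∈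
choose-sound (suc n) (suc k) p∈ with ∈-++⁻ (map (inside ∷_) (choose n k)) p∈
... | inj₁ p∈ with q , q∈ , refl ← ∈-map⁻ _ p∈ = cong suc (choose-sound n k q∈)
... | inj₂ p∈ with q , q∈ , refl ← ∈-map⁻ _ p∈ = choose-sound n (suc k) q∈

choose-unique : ∀ n k → Unique (choose n k)
choose-unique zero    zero    = [] ∷ []
choose-unique zero    (suc k) = []
choose-unique (suc n) zero    = Unique.map⁺ (λ { refl → refl }) (choose-unique n zero)
choose-unique (suc n) (suc k) = Unique.++⁺
  (Unique.map⁺ (λ { refl → refl }) (choose-unique n k))
  (Unique.map⁺ (λ { refl → refl }) (choose-unique n (suc k)))
  λ { (p∈ , p∈′) → case ∈-map⁻ _ p∈ of λ { (_ , _ , refl) → case ∈-map⁻ _ p∈′ of λ { (_ , _ , ()) } } }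

length-choose-suc : ∀ n k → length (choose (suc n) (suc k)) ≡ length (choose n k) + length (choose n (suc k))
length-choose-suc n k = trans (length-++ (map (inside ∷_) (choose n k))) (cong₂ _+_ (length-map (inside ∷_) (choose n k)) (length-map (outside ∷_) (choose n (suc k))))

length-choose₀ : ∀ n → length (choose n 0) ≡ 1
length-choose₀ zero    = refl
length-choose₀ (suc n) = trans (length-map (outside ∷_) (choose n 0)) (length-choose₀ n)

length-choose₁ : ∀ n → length (choose n 1) ≡ n
length-choose₁ zero    = refl
length-choose₁ (suc n) = trans (length-choose-suc n 0) (cong₂ _+_ (length-choose₀ n) (length-choose₁ n))

length-choose₂ : ∀ n → length (choose n 2) ≡ c₂ n
length-choose₂ zero    = refl
length-choose₂ (suc n) = trans (length-choose-suc n 1) (cong₂ _+_ (length-choose₁ n) (length-choose₂ n))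

length-choose₃ : ∀ n → length (choose n 3) ≡ c₃ n
length-choose₃ zero    = refl
length-choose₃ (suc n) = trans (length-choose-suc n 2) (cong₂ _+_ (length-choose₂ n) (length-choose₃ n))

∣p∣≡0⇒p≡⊥ : (p : Subset n) → ∣ p ∣ ≡ 0 → p ≡ ⊥
∣p∣≡0⇒p≡⊥ []            eq = refl
∣p∣≡0⇒p≡⊥ (outside ∷ p) eq = cong (outside ∷_) (∣p∣≡0⇒p≡⊥ p eq)

-- The least element of `p` is split off. Three applications turn a set of size 3 into three
-- distinct vertices.
∣p∣≡1+k⇒p≡⁅x⁆∪q : (p : Subset n) → ∣ p ∣ ≡ suc k → ∃₂ λ x q → p ≡ ⁅ x ⁆ ∪ q × x ∉ q × ∣ q ∣ ≡ k
∣p∣≡1+k⇒p≡⁅x⁆∪q (inside ∷ p)  eq = zero , outside ∷ p , cong (inside ∷_) (sym (∪-identityˡ p)) , (λ ()) , suc-injective eq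
∣p∣≡1+k⇒p≡⁅x⁆∪q (outside ∷ p) eq with x , q , refl , x∉q , ∣q∣ ← ∣p∣≡1+k⇒p≡⁅x⁆∪q p eq =
  suc x , outside ∷ q , refl , x∉q ∘ drop-there , ∣q∣

∣p∪q∣≤∣p∣+∣q∣ : (p q : Subset n) → ∣ p ∪ q ∣ ≤ ∣ p ∣ + ∣ q ∣
∣p∪q∣≤∣p∣+∣q∣ []            []            = z≤n
∣p∪q∣≤∣p∣+∣q∣ (outside ∷ p) (outside ∷ q) = ∣p∪q∣≤∣p∣+∣q∣ p q
∣p∪q∣≤∣p∣+∣q∣ (outside ∷ p) (inside ∷ q)  = ≤-trans (s≤s (∣p∪q∣≤∣p∣+∣q∣ p q)) (≤-reflexive (sym (+-suc ∣ p ∣ ∣ q ∣)))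
∣p∪q∣≤∣p∣+∣q∣ (inside ∷ p)  (outside ∷ q) = s≤s (∣p∪q∣≤∣p∣+∣q∣ p q)
∣p∪q∣≤∣p∣+∣q∣ (inside ∷ p)  (inside ∷ q)  = s≤s (≤-trans (∣p∪q∣≤∣p∣+∣q∣ p q) (+-monoʳ-≤ ∣ p ∣ (m≤n⇒m≤1+n ≤-refl)))

-- Triples as unions of singletons

⦅_,_,_⦆ : Fin v → Fin v → Fin v → Subset v
⦅ x , y , z ⦆ = ⁅ x ⁆ ∪ ⁅ y ⁆ ∪ ⁅ z ⁆

⦅⦆-swap₁₂ : (x y z : Fin v) → ⦅ x , y , z ⦆ ≡ ⦅ y , x , z ⦆
⦅⦆-swap₁₂ x y z = trans (sym (∪-assoc ⁅ x ⁆ ⁅ y ⁆ ⁅ z ⁆)) (trans (cong (_∪ ⁅ z ⁆) (∪-comm ⁅ x ⁆ ⁅ y ⁆)) (∪-assoc ⁅ y ⁆ ⁅ x ⁆ ⁅ z ⁆))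

⦅⦆-swap₂₃ : (x y z : Fin v) → ⦅ x , y , z ⦆ ≡ ⦅ x , z , y ⦆
⦅⦆-swap₂₃ x y z = cong (⁅ x ⁆ ∪_) (∪-comm ⁅ y ⁆ ⁅ z ⁆)

∈-⦅⦆⁻ : {x a b c : Fin v} → x ∈ ⦅ a , b , c ⦆ → x ≡ a ⊎ x ≡ b ⊎ x ≡ c
∈-⦅⦆⁻ {a = a} {b} {c} x∈ with x∈p∪q⁻ ⁅ a ⁆ (⁅ b ⁆ ∪ ⁅ c ⁆) x∈
... | inj₁ x∈a = inj₁ (x∈⁅y⁆⇒x≡y a x∈a)
... | inj₂ x∈bc with x∈p∪q⁻ ⁅ b ⁆ ⁅ c ⁆ x∈bc
...   | inj₁ x∈b = inj₂ (inj₁ (x∈⁅y⁆⇒x≡y b x∈b))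
...   | inj₂ x∈c = inj₂ (inj₂ (x∈⁅y⁆⇒x≡y c x∈c))

∈-⦅⦆⁺ : {x a b c : Fin v} → x ≡ a ⊎ x ≡ b ⊎ x ≡ c → x ∈ ⦅ a , b , c ⦆
∈-⦅⦆⁺ {x = x} (inj₁ refl)        = x∈p∪q⁺ (inj₁ (x∈⁅x⁆ x))
∈-⦅⦆⁺ {x = x} (inj₂ (inj₁ refl)) = x∈p∪q⁺ (inj₂ (x∈p∪q⁺ (inj₁ (x∈⁅x⁆ x))))
∈-⦅⦆⁺ {x = x} (inj₂ (inj₂ refl)) = x∈p∪q⁺ (inj₂ (x∈p∪q⁺ (inj₂ (x∈⁅x⁆ x))))

module _ {u v : ℕ} (f : Fin u → Fin v) where

  ⦅⦆-map-∈⁺ : ∀ {x a b c} → x ∈ ⦅ a , b , c ⦆ → f x ∈ ⦅ f a , f b , f c ⦆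
  ⦅⦆-map-∈⁺ x∈ with ∈-⦅⦆⁻ x∈
  ... | inj₁ refl        = ∈-⦅⦆⁺ (inj₁ refl)
  ... | inj₂ (inj₁ refl) = ∈-⦅⦆⁺ (inj₂ (inj₁ refl))
  ... | inj₂ (inj₂ refl) = ∈-⦅⦆⁺ (inj₂ (inj₂ refl))

  ⦅⦆-map-∈⁻ : ∀ {x a b c} → x ∈ ⦅ f a , f b , f c ⦆ → ∃[ y ] x ≡ f y × y ∈ ⦅ a , b , c ⦆
  ⦅⦆-map-∈⁻ {a = a} {b} {c} x∈ with ∈-⦅⦆⁻ x∈
  ... | inj₁ refl        = a , refl , ∈-⦅⦆⁺ (inj₁ refl)
  ... | inj₂ (inj₁ refl) = b , refl , ∈-⦅⦆⁺ (inj₂ (inj₁ refl))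
  ... | inj₂ (inj₂ refl) = c , refl , ∈-⦅⦆⁺ (inj₂ (inj₂ refl))

  ⦅⦆-map-⊆ : ∀ {a b c a′ b′ c′} → ⦅ a , b , c ⦆ ⊆ ⦅ a′ , b′ , c′ ⦆ → ⦅ f a , f b , f c ⦆ ⊆ ⦅ f a′ , f b′ , f c′ ⦆
  ⦅⦆-map-⊆ abc⊆ x∈ with y , refl , y∈ ← ⦅⦆-map-∈⁻ x∈ = ⦅⦆-map-∈⁺ (abc⊆ y∈)

  -- Both sides are images under `f` of the same set. This carries identities between triples of
  -- labels, settled by finite computation, over to an arbitrary vertex set.
  ⦅⦆-map : ∀ {a b c a′ b′ c′} → ⦅ a , b , c ⦆ ≡ ⦅ a′ , b′ , c′ ⦆ → ⦅ f a , f b , f c ⦆ ≡ ⦅ f a′ , f b′ , f c′ ⦆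
  ⦅⦆-map eq = ⊆-antisym (⦅⦆-map-⊆ λ {x} → subst (x ∈_) eq) (⦅⦆-map-⊆ λ {x} → subst (x ∈_) (sym eq))

  module _ (f-inj : Injective _≡_ _≡_ f) where

    ⦅⦆-map-⊆⁻ : ∀ {a b c a′ b′ c′} → ⦅ f a , f b , f c ⦆ ⊆ ⦅ f a′ , f b′ , f c′ ⦆ → ⦅ a , b , c ⦆ ⊆ ⦅ a′ , b′ , c′ ⦆
    ⦅⦆-map-⊆⁻ fabc⊆ x∈ with y , fx≡fy , y∈ ← ⦅⦆-map-∈⁻ (fabc⊆ (⦅⦆-map-∈⁺ x∈)) = subst (_∈ _) (sym (f-inj fx≡fy)) y∈

    ⦅⦆-map⁻ : ∀ {a b c a′ b′ c′} → ⦅ f a , f b , f c ⦆ ≡ ⦅ f a′ , f b′ , f c′ ⦆ → ⦅ a , b , c ⦆ ≡ ⦅ a′ , b′ , c′ ⦆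
    ⦅⦆-map⁻ eq = ⊆-antisym (⦅⦆-map-⊆⁻ λ {x} → subst (x ∈_) eq) (⦅⦆-map-⊆⁻ λ {x} → subst (x ∈_) (sym eq))

∣⦅x,x,z⦆∣≢3 : (x z : Fin v) → ∣ ⦅ x , x , z ⦆ ∣ ≢ 3
∣⦅x,x,z⦆∣≢3 x z eq = n≮n 2 (begin-strict
  2                            <⟨ ≤-refl ⟩
  3                            ≡⟨ eq ⟨
  ∣ ⁅ x ⁆ ∪ (⁅ x ⁆ ∪ ⁅ z ⁆) ∣  ≡⟨ cong ∣_∣ (∪-assoc ⁅ x ⁆ ⁅ x ⁆ ⁅ z ⁆) ⟨
  ∣ (⁅ x ⁆ ∪ ⁅ x ⁆) ∪ ⁅ z ⁆ ∣  ≡⟨ cong (λ p → ∣ p ∪ ⁅ z ⁆ ∣) (∪-idem ⁅ x ⁆) ⟩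
  ∣ ⁅ x ⁆ ∪ ⁅ z ⁆ ∣            ≤⟨ ∣p∪q∣≤∣p∣+∣q∣ ⁅ x ⁆ ⁅ z ⁆ ⟩
  ∣ ⁅ x ⁆ ∣ + ∣ ⁅ z ⁆ ∣        ≡⟨ cong₂ _+_ (∣⁅x⁆∣≡1 x) (∣⁅x⁆∣≡1 z) ⟩
  2                            ∎)
  where open ≤-Reasoning

∣p∣≡3⇒p≡⦅⦆ : (p : Subset v) → ∣ p ∣ ≡ 3 → ∃[ x ] ∃[ y ] ∃[ z ] p ≡ ⦅ x , y , z ⦆ × x ≢ y × x ≢ z × y ≢ z
∣p∣≡3⇒p≡⦅⦆ p ∣p∣≡3
  with x , q , refl , x∉q , ∣q∣≡2 ← ∣p∣≡1+k⇒p≡⁅x⁆∪q p ∣p∣≡3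
  with y , r , refl , y∉r , ∣r∣≡1 ← ∣p∣≡1+k⇒p≡⁅x⁆∪q q ∣q∣≡2
  with z , s , refl , z∉s , ∣s∣≡0 ← ∣p∣≡1+k⇒p≡⁅x⁆∪q r ∣r∣≡1
  with refl ← ∣p∣≡0⇒p≡⊥ s ∣s∣≡0
  = x , y , z , cong (λ r → ⁅ x ⁆ ∪ ⁅ y ⁆ ∪ r) (∪-identityʳ ⁅ z ⁆)
  , (λ { refl → x∉q (x∈p∪q⁺ (inj₁ (x∈⁅x⁆ x))) })
  , (λ { refl → x∉q (x∈p∪q⁺ (inj₂ (x∈p∪q⁺ (inj₁ (x∈⁅x⁆ x))))) })
  , (λ { refl → y∉r (x∈p∪q⁺ (inj₁ (x∈⁅x⁆ y))) })

_≟ˢ_ : DecidableEquality (Subset n)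
_≟ˢ_ = ≡-dec _≟ᵇ_

-- Closed sequences of length six

Hexagon : ℕ → Set
Hexagon v = Fin 6 → Fin v

-- The formula is that of `triple` for `k = 6`, so the edges of a `Cycle` and of its underlying
-- hexagon agree by definition. Distinctness of the vertices is left to `hexagon-injective`.
edge : Hexagon v → Fin 6 → Subset v
edge w i = ⦅ w ((toℕ i + 0) mod 6) , w ((toℕ i + 1) mod 6) , w ((toℕ i + 2) mod 6) ⦆

edgeList : Hexagon v → List (Subset v)
edgeList w = map (edge w) (allFin 6)

edgeLists : List (Hexagon v) → List (Subset v)
edgeLists = concatMap edgeList

Covered : List (Hexagon v) → Subset v → Set
Covered ws e = Any (λ w → ∃[ i ] e ≡ edge w i) ws

covered? : (ws : List (Hexagon v)) (e : Subset v) → Dec (Covered ws e)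
covered? ws e = Any.any? (λ w → any? λ i → e ≟ˢ edge w i) ws

∈-edgeLists⁺ : {ws : List (Hexagon v)} {e : Subset v} → Covered ws e → e ∈ₗ edgeLists ws
∈-edgeLists⁺ = ∈-concatMap⁺ edgeList ∘ Any.map λ { {w} (i , refl) → ∈-map⁺ (edge w) (∈-allFin i) }

∈-edgeList⁻ : (w : Hexagon v) {e : Subset v} → e ∈ₗ edgeList w → ∃[ i ] e ≡ edge w i
∈-edgeList⁻ w e∈ with i , _ , eq ← ∈-map⁻ (edge w) {xs = allFin 6} e∈ = i , eq

∈-edgeLists⁻ : (ws : List (Hexagon v)) {e : Subset v} → e ∈ₗ edgeLists ws → Covered ws e
∈-edgeLists⁻ ws e∈ = Any.map (λ {w} → ∈-edgeList⁻ w) (∈-concatMap⁻ edgeList {xs = ws} e∈)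

covered-map : (f : Fin n → Fin v) (ws : List (Hexagon n)) {a b c : Fin n} →
  Covered ws ⦅ a , b , c ⦆ → Covered (map (f ∘_) ws) ⦅ f a , f b , f c ⦆
covered-map f ws = Any.map⁺ ∘ Any.map λ { (i , eq) → i , ⦅⦆-map f eq }

-- The hexagon `id` on `Fin 6` is universal: any hexagon `w` is its image under `w`, so facts about
-- positions are decided here by evaluation and then transported.
edge-id-injective : ∀ i j → edge id i ≡ edge id j → i ≡ j
edge-id-injective = toWitness {a? = all? λ i → all? λ j → edge id i ≟ˢ edge id j →-dec i ≟ᶠ j} tt

edgeList-unique : {w : Hexagon v} → Injective _≡_ _≡_ w → Unique (edgeList w)
edgeList-unique {w = w} w-inj = Unique.map⁺ (λ {i j} eq → edge-id-injective i j (⦅⦆-map⁻ w w-inj eq)) (Unique.allFin⁺ 6)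

-- Two positions of a hexagon lie on a common edge, or are antipodal and complete the same pair to an edge.
positions : ∀ i j → i ≡ j
  ⊎ (∃[ m ] ∃[ k ] edge id m ≡ ⦅ i , j , k ⦆)
  ⊎ (∃[ m ] ∃[ k ] ∃[ l ] edge id m ≡ ⦅ i , k , l ⦆ × ∃[ n ] edge id n ≡ ⦅ j , k , l ⦆ × m ≢ n)
positions = toWitness {a? = all? λ i → all? λ j → i ≟ᶠ j
  ⊎-dec (any? λ m → any? λ k → edge id m ≟ˢ ⦅ i , j , k ⦆)
  ⊎-dec (any? λ m → any? λ k → any? λ l → edge id m ≟ˢ ⦅ i , k , l ⦆
         ×-dec any? λ n → edge id n ≟ˢ ⦅ j , k , l ⦆ ×-dec ¬? (m ≟ᶠ n))} tt

edge-map : (w : Hexagon v) → ∀ m {a b c} → edge id m ≡ ⦅ a , b , c ⦆ → edge w m ≡ ⦅ w a , w b , w c ⦆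
edge-map w m = ⦅⦆-map w {(toℕ m + 0) mod 6} {(toℕ m + 1) mod 6} {(toℕ m + 2) mod 6}

-- A vertex repeated at two positions of a common edge would leave that edge with at most two
-- points. Repeated at antipodal positions, it would make two edges of the hexagon coincide.
hexagon-injective : (w : Hexagon v) → Unique (edgeList w) → (∀ i → ∣ edge w i ∣ ≡ 3) → Injective _≡_ _≡_ w
hexagon-injective w w! size {i} {j} wi≡wj = [ id , [ adjacent , antipodal ]′ ]′ (positions i j)
  where
  open ≡-Reasoning
  adjacent : (∃[ m ] ∃[ k ] edge id m ≡ ⦅ i , j , k ⦆) → i ≡ j
  adjacent (m , k , eq) = contradiction (begin
    ∣ ⦅ w i , w i , w k ⦆ ∣  ≡⟨ cong (λ x → ∣ ⦅ w i , x , w k ⦆ ∣) wi≡wj ⟩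
    ∣ ⦅ w i , w j , w k ⦆ ∣  ≡⟨ cong ∣_∣ (edge-map w m eq) ⟨
    ∣ edge w m ∣             ≡⟨ size m ⟩
    3                        ∎)
    (∣⦅x,x,z⦆∣≢3 (w i) (w k))
  antipodal : (∃[ m ] ∃[ k ] ∃[ l ] edge id m ≡ ⦅ i , k , l ⦆ × ∃[ n ] edge id n ≡ ⦅ j , k , l ⦆ × m ≢ n) → i ≡ j
  antipodal (m , k , l , eq , n , eq′ , m≢n) = contradiction
    (unique-map⇒injective (edge w) w! (∈-allFin m) (∈-allFin n) (begin
      edge w m               ≡⟨ edge-map w m eq ⟩
      ⦅ w i , w k , w l ⦆    ≡⟨ cong (λ x → ⦅ x , w k , w l ⦆) wi≡wj ⟩
      ⦅ w j , w k , w l ⦆    ≡⟨ edge-map w n eq′ ⟨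
      edge w n               ∎))
    m≢n

-- Uniqueness of the concatenated edge list serves twice: within one hexagon it helps to make the
-- vertices distinct, and between hexagons it makes the cycles edge-disjoint. The equation with `ws`
-- lets coverage pass to the cycles.
toCycles : (ws : List (Hexagon v)) → Unique (edgeLists ws) → (∀ {e} → e ∈ₗ edgeLists ws → ∣ e ∣ ≡ 3) →
  Σ (List (Cycle 6 v)) λ Cs → map Cycle.vertex Cs ≡ ws × AllPairs (λ C D → ∀ {e} → ¬ (edges C e × edges D e)) Cs
toCycles [] _ _ = [] , refl , []
toCycles (w ∷ ws) ws! size
  with w! , ws′! , w#ws ← unique-++⁻ (edgeList w) ws!
  with Cs , refl , Cs# ← toCycles ws ws′! (size ∘ ∈-++⁺ʳ (edgeList w))
  = record { vertex = w ; distinct = hexagon-injective w w! λ i → size (∈-++⁺ˡ (∈-map⁺ (edge w) (∈-allFin i))) } ∷ Cs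
  , refl
  , All.tabulate (λ { D∈Cs ((i , refl) , D∋e) → w#ws (∈-map⁺ (edge w) (∈-allFin i) , ∈-edgeLists⁺ (Any.map⁺ (lose D∈Cs D∋e))) }) ∷ Cs#

length-edgeLists : (ws : List (Hexagon v)) → length (edgeLists ws) ≡ 6 * length ws
length-edgeLists = length-concatMap-const edgeList λ _ → refl

-- Pairs and triples of list elements

pairs : List A → List (A × A)
pairs []       = []
pairs (x ∷ xs) = map (x ,_) xs ++ pairs xs

length-pairs : (xs : List A) → length (pairs xs) ≡ c₂ (length xs)
length-pairs []       = refl
length-pairs (x ∷ xs) = trans (length-++ (map (x ,_) xs)) (cong₂ _+_ (length-map _ xs) (length-pairs xs))

pairs⇒AllPairs : {R : A → A → Set} (xs : List A) → All (uncurry R) (pairs xs) → AllPairs R xs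
pairs⇒AllPairs []       _ = []
pairs⇒AllPairs (x ∷ xs) R with Rx , Rxs ← All.++⁻ (map (x ,_) xs) R = All.map⁻ Rx ∷ pairs⇒AllPairs xs Rxs

AllTriples : (A → A → A → Set) → List A → Set
AllTriples P []       = ⊤
AllTriples P (x ∷ xs) = AllPairs (P x) xs × AllTriples P xs

-- Each quadruple (a , b , c , d) stands for the two triples abc and abd, which share the pair ab.
Quad : Set → Set
Quad A = A × A × A × A

-- The four triples that extend an old pair `ab` by one new point share `ab`, so they can be matched
-- in any way.
overPair : A → A → A → A → A × A → List (Quad A)
overPair w x y z (a , b) = (a , b , w , x) ∷ (a , b , y , z) ∷ []

-- Triples of `a` with two new points correspond to the six edges of K₄ on `w`, `x`, `y`, `z`. These
-- split into three paths of length two, centred at `w`, `z` and `y`; the two triples of a path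
-- share `a` and the centre.
overPoint : A → A → A → A → A → List (Quad A)
overPoint w x y z a = (w , a , x , y) ∷ (z , a , w , x) ∷ (y , a , x , z) ∷ []

-- Triples are sorted by whether they contain one, two, three or none of the first four points, the
-- last kind being left to the recursion. Lists of length at most two have no triples, while a list
-- of length three has a single triple without a partner: the excluded residue.
quads : List A → List (Quad A)
quads (w ∷ x ∷ y ∷ z ∷ xs) =
  concatMap (overPair w x y z) (pairs xs) ++
  concatMap (overPoint w x y z) xs ++
  (w , x , y , z) ∷ (y , z , w , x) ∷ quads xs
quads _ = []

-- The three kinds contribute `2 * c₂ l`, `3 * l` and 2 quads, which is half of the even part in
-- `c₃-4+`.
length-quads : (xs : List A) → length xs % 4 ≢ 3 → 2 * length (quads xs) ≡ c₃ (length xs)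
length-quads []           _ = refl
length-quads (_ ∷ [])     _ = refl
length-quads (_ ∷ _ ∷ []) _ = refl
length-quads (_ ∷ _ ∷ _ ∷ [])  ≢3 = contradiction refl ≢3
length-quads (w ∷ x ∷ y ∷ z ∷ xs) ≢3 = begin
  2 * length (ps ++ as ++ _ ∷ _ ∷ quads xs)                       ≡⟨ cong (2 *_) (trans (length-++ ps) (cong (length ps +_) (length-++ as))) ⟩
  2 * (length ps + (length as + (2 + length (quads xs))))         ≡⟨ cong (2 *_) (cong₂ _+_ ps-length (cong (_+ _) as-length)) ⟩
  2 * (2 * c₂ l + (3 * l + (2 + length (quads xs))))              ≡⟨ eq (c₂ l) l (length (quads xs)) ⟩
  -- Since `(4 + l) % 4` computes to `l % 4`, the hypothesis applies to the tail as it stands.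
  2 * (2 * c₂ l + (3 * l + 2)) + 2 * length (quads xs)            ≡⟨ cong (2 * (2 * c₂ l + (3 * l + 2)) +_) (length-quads xs ≢3) ⟩
  2 * (2 * c₂ l + (3 * l + 2)) + c₃ l                             ≡⟨ c₃-4+ l ⟨
  c₃ (4 + l)                                                      ∎
  where
  open ≡-Reasoning
  l = length xs
  ps = concatMap (overPair w x y z) (pairs xs)
  as = concatMap (overPoint w x y z) xs
  ps-length : length ps ≡ 2 * c₂ l
  ps-length = trans (length-concatMap-const _ (λ _ → refl) (pairs xs)) (cong (2 *_) (length-pairs xs))
  as-length : length as ≡ 3 * l
  as-length = length-concatMap-const _ (λ _ → refl) xs
  eq : ∀ c n q → 2 * (2 * c + (3 * n + (2 + q))) ≡ 2 * (2 * c + (3 * n + 2)) + 2 * q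
  eq = solve-∀

module _ {A : Set} {P : A → A → A → Set}
  (swap₁₂ : ∀ {a b c} → P a b c → P b a c) (swap₂₃ : ∀ {a b c} → P a b c → P a c b) where

  rotate : ∀ {a b c} → P a b c → P c a b
  rotate = swap₁₂ ∘ swap₂₃

  -- Up to order, each triple of list entries is one of the two encoded by some quad, and the two
  -- swaps generate all reorderings.
  quads⇒AllTriples : ∀ xs → length xs % 4 ≢ 3 →
    (∀ {a b c d} → (a , b , c , d) ∈ₗ quads xs → P a b c × P a b d) → AllTriples P xs
  quads⇒AllTriples []           _ _ = tt
  quads⇒AllTriples (_ ∷ [])     _ _ = [] , tt
  quads⇒AllTriples (_ ∷ _ ∷ []) _ _ = [] ∷ [] , [] , tt
  quads⇒AllTriples (_ ∷ _ ∷ _ ∷ []) ≢3 _ = contradiction refl ≢3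
  quads⇒AllTriples (w ∷ x ∷ y ∷ z ∷ xs) ≢3 hyp =
      (wxy ∷ wxz ∷ All.tabulate wx) ∷ (wyz ∷ All.tabulate wy) ∷ All.tabulate wz ∷ two (proj₁ ∘ wxPair)
    , (xyz ∷ All.tabulate xy) ∷ All.tabulate xz ∷ two (proj₂ ∘ wxPair)
    , All.tabulate yz ∷ two (proj₁ ∘ yzPair)
    , two (proj₂ ∘ yzPair)
    , quads⇒AllTriples xs ≢3 (hyp ∘ ∈-++⁺ʳ ps ∘ ∈-++⁺ʳ as ∘ there ∘ there)
    where
    ps = concatMap (overPair w x y z) (pairs xs)
    as = concatMap (overPoint w x y z) xs
    last₁ = hyp (∈-++⁺ʳ ps (∈-++⁺ʳ as (here refl)))
    last₂ = hyp (∈-++⁺ʳ ps (∈-++⁺ʳ as (there (here refl))))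
    wxy = proj₁ last₁
    wxz = proj₂ last₁
    wyz = rotate (proj₁ last₂)
    xyz = rotate (proj₂ last₂)
    mid : ∀ {q a} → a ∈ₗ xs → q ∈ₗ overPoint w x y z a → q ∈ₗ quads (w ∷ x ∷ y ∷ z ∷ xs)
    mid a∈ q∈ = ∈-++⁺ʳ ps (∈-++⁺ˡ (∈-concatMap⁺ (overPoint w x y z) (lose a∈ q∈)))
    wx : ∀ {a} → a ∈ₗ xs → P w x a
    wx a∈ = swap₂₃ (proj₁ (hyp (mid a∈ (here refl))))
    wy : ∀ {a} → a ∈ₗ xs → P w y a
    wy a∈ = swap₂₃ (proj₂ (hyp (mid a∈ (here refl))))
    wz : ∀ {a} → a ∈ₗ xs → P w z a
    wz a∈ = rotate (proj₁ (hyp (mid a∈ (there (here refl)))))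
    xz : ∀ {a} → a ∈ₗ xs → P x z a
    xz a∈ = rotate (proj₂ (hyp (mid a∈ (there (here refl)))))
    xy : ∀ {a} → a ∈ₗ xs → P x y a
    xy a∈ = rotate (proj₁ (hyp (mid a∈ (there (there (here refl))))))
    yz : ∀ {a} → a ∈ₗ xs → P y z a
    yz a∈ = swap₂₃ (proj₂ (hyp (mid a∈ (there (there (here refl))))))
    fst : ∀ {q ab} → ab ∈ₗ pairs xs → q ∈ₗ overPair w x y z ab → q ∈ₗ quads (w ∷ x ∷ y ∷ z ∷ xs)
    fst ab∈ q∈ = ∈-++⁺ˡ (∈-concatMap⁺ (overPair w x y z) (lose ab∈ q∈))
    wxPair : ∀ {ab} → ab ∈ₗ pairs xs → P (proj₁ ab) (proj₂ ab) w × P (proj₁ ab) (proj₂ ab) x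
    wxPair ab∈ = hyp (fst ab∈ (here refl))
    yzPair : ∀ {ab} → ab ∈ₗ pairs xs → P (proj₁ ab) (proj₂ ab) y × P (proj₁ ab) (proj₂ ab) z
    yzPair ab∈ = hyp (fst ab∈ (there (here refl)))
    two : ∀ {u} → (∀ {ab} → ab ∈ₗ pairs xs → P (proj₁ ab) (proj₂ ab) u) → AllPairs (P u) xs
    two hyp′ = pairs⇒AllPairs xs (All.tabulate (rotate ∘ hyp′))

  allTriples-lookup : ∀ {xs} → AllTriples P xs → ∀ {a b c} → a ∈ₗ xs → b ∈ₗ xs → c ∈ₗ xs →
    a ≡ b ⊎ a ≡ c ⊎ b ≡ c ⊎ P a b c
  allTriples-lookup {_ ∷ _} _ (here refl) (here refl) _           = inj₁ refl
  allTriples-lookup {_ ∷ _} _ (here refl) (there _)   (here refl) = inj₂ (inj₁ refl)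
  allTriples-lookup {_ ∷ _} _ (there _)   (here refl) (here refl) = inj₂ (inj₂ (inj₁ refl))
  allTriples-lookup {_ ∷ _} (Px , _) (here refl) (there b∈) (there c∈) with allPairs-lookup swap₂₃ Px b∈ c∈
  ... | inj₁ b≡c = inj₂ (inj₂ (inj₁ b≡c))
  ... | inj₂ Pxbc = inj₂ (inj₂ (inj₂ Pxbc))
  allTriples-lookup {_ ∷ _} (Px , _) (there a∈) (here refl) (there c∈) with allPairs-lookup swap₂₃ Px a∈ c∈
  ... | inj₁ a≡c = inj₂ (inj₁ a≡c)
  ... | inj₂ Pxac = inj₂ (inj₂ (inj₂ (swap₁₂ Pxac)))
  allTriples-lookup {_ ∷ _} (Px , _) (there a∈) (there b∈) (here refl) with allPairs-lookup swap₂₃ Px a∈ b∈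
  ... | inj₁ a≡b = inj₁ a≡b
  ... | inj₂ Pxab = inj₂ (inj₂ (inj₂ (swap₂₃ (swap₁₂ Pxab))))
  allTriples-lookup {_ ∷ _} (_ , Pxs) (there a∈) (there b∈) (there c∈) = allTriples-lookup Pxs a∈ b∈ c∈

-- Hexagons on two and on four groups

Group : ℕ → Set
Group v = Fin 3 → Fin v

⟦_⟧ : Group v → Subset v
⟦ G ⟧ = ⦅ G 0F , G 1F , G 2F ⦆

_⊕_ : Fin 3 → Fin 3 → Fin 3
i ⊕ j = (toℕ i + toℕ j) mod 3

-- One hexagon developed under ℤ₃. An edge with two vertices in one group is given by the index `i`
-- missing from that group and the index `k` used in the other. The base hexagon has three edges of
-- either sort, and they realise every value of `k − i`.
pairGadget : List (Hexagon 6)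
pairGadget = map hexagon (allFin 3)
  where
  G H : Group 6
  G = combine {2} {3} 0F
  H = combine {2} {3} 1F
  hexagon : Fin 3 → Hexagon 6
  hexagon s = lookup (G s ∷ G (s ⊕ 1F) ∷ H s ∷ G (s ⊕ 2F) ∷ H (s ⊕ 2F) ∷ H (s ⊕ 1F) ∷ [])

pairGadget-covers : ∀ g h i j k → g ≢ h → i ≢ j →
  Covered pairGadget ⦅ combine {2} {3} g i , combine {2} {3} g j , combine {2} {3} h k ⦆
pairGadget-covers = toWitness {a? = all? λ g → all? λ h → all? λ i → all? λ j → all? λ k →
  ¬? (g ≟ᶠ h) →-dec ¬? (i ≟ᶠ j) →-dec covered? pairGadget _} tt

-- One hexagon developed under ℤ₃ × ℤ₃: its three edges through C realise every
-- value of k − i − j on triples (Aᵢ , Bⱼ , Cₖ), and likewise for D.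
quadGadget : List (Hexagon 12)
quadGadget = map (uncurry hexagon) (cartesianProduct (allFin 3) (allFin 3))
  where
  A′ B′ C′ D′ : Group 12
  A′ = combine {4} {3} 0F
  B′ = combine {4} {3} 1F
  C′ = combine {4} {3} 2F
  D′ = combine {4} {3} 3F
  hexagon : Fin 3 → Fin 3 → Hexagon 12
  hexagon s t = lookup (A′ s ∷ B′ t ∷ C′ (s ⊕ t) ∷ A′ (s ⊕ 1F) ∷ B′ (t ⊕ 1F) ∷ D′ (s ⊕ t) ∷ [])

quadGadget-covers : ∀ i j k →
  Covered quadGadget ⦅ combine {4} {3} 0F i , combine {4} {3} 1F j , combine {4} {3} 2F k ⦆ ×
  Covered quadGadget ⦅ combine {4} {3} 0F i , combine {4} {3} 1F j , combine {4} {3} 3F k ⦆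
quadGadget-covers = toWitness {a? = all? λ i → all? λ j → all? λ k →
  covered? quadGadget _ ×-dec covered? quadGadget _} tt

-- The gadgets live on the fixed set `Fin (n * 3)`, where coverage is checked by evaluation. This
-- map places them on actual groups.
label : (Fin n → Group v) → Fin (n * 3) → Fin v
label Gs l = uncurry Gs (remQuot 3 l)

label-combine : (Gs : Fin n → Group v) (g : Fin n) (i : Fin 3) → label Gs (combine g i) ≡ Gs g i
label-combine Gs g i = cong (uncurry Gs) (remQuot-combine g i)

covered-label : (Gs : Fin n → Group v) (ws : List (Hexagon (n * 3))) → ∀ g h l i j k →
  Covered ws ⦅ combine g i , combine h j , combine l k ⦆ →
  Covered (map (label Gs ∘_) ws) ⦅ Gs g i , Gs h j , Gs l k ⦆
covered-label Gs ws g h l i j k c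
  rewrite sym (label-combine Gs g i) | sym (label-combine Gs h j) | sym (label-combine Gs l k)
  = covered-map (label Gs) ws c

pairHexagons : Group v × Group v → List (Hexagon v)
pairHexagons (G , H) = map (label (lookup (G ∷ H ∷ [])) ∘_) pairGadget

quadHexagons : Quad (Group v) → List (Hexagon v)
quadHexagons (G , H , K , L) = map (label (lookup (G ∷ H ∷ K ∷ L ∷ [])) ∘_) quadGadget

hexagons : List (Group v) → List (Hexagon v)
hexagons Gs = concatMap pairHexagons (pairs Gs) ++ concatMap quadHexagons (quads Gs)

-- Every triple of vertices is covered

group-full : (G : Group v) → ∀ i j k → i ≢ j → i ≢ k → j ≢ k → ⦅ G i , G j , G k ⦆ ≡ ⟦ G ⟧
group-full G i j k i≢j i≢k j≢k = ⦅⦆-map G (full i j k i≢j i≢k j≢k)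
  where
  full : ∀ (i j k : Fin 3) → i ≢ j → i ≢ k → j ≢ k → ⦅ i , j , k ⦆ ≡ ⦅ 0F , 1F , 2F ⦆
  full = toWitness {a? = all? λ i → all? λ j → all? λ k →
    ¬? (i ≟ᶠ j) →-dec ¬? (i ≟ᶠ k) →-dec ¬? (j ≟ᶠ k) →-dec ⦅ i , j , k ⦆ ≟ˢ ⦅ 0F , 1F , 2F ⦆} tt

-- Both distributions, two vertices in `G` or two in `H`, are included to make the relation
-- symmetric, as `allPairs-lookup` requires.
Pair : List (Hexagon v) → Group v → Group v → Set
Pair ws G H = ∀ i j k → i ≢ j → Covered ws ⦅ G i , G j , H k ⦆ × Covered ws ⦅ H i , H j , G k ⦆

Transversal : List (Hexagon v) → Group v → Group v → Group v → Set
Transversal ws G H K = ∀ i j k → Covered ws ⦅ G i , H j , K k ⦆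

module _ {v : ℕ} {ws : List (Hexagon v)} where

  pair-sym : ∀ {G H} → Pair ws G H → Pair ws H G
  pair-sym c i j k i≢j = let p , q = c i j k i≢j in q , p

  transversal-swap₁₂ : ∀ {G H K} → Transversal ws G H K → Transversal ws H G K
  transversal-swap₁₂ c i j k = subst (Covered ws) (⦅⦆-swap₁₂ _ _ _) (c j i k)

  transversal-swap₂₃ : ∀ {G H K} → Transversal ws G H K → Transversal ws G K H
  transversal-swap₂₃ c i j k = subst (Covered ws) (⦅⦆-swap₂₃ _ _ _) (c i k j)

  module _ {Gs : List (Group v)}
    (pairs-covered : AllPairs (Pair ws) Gs) (transversals-covered : AllTriples (Transversal ws) Gs) where

    Done : Subset v → Set
    Done e = Covered ws e ⊎ e ∈ₗ map ⟦_⟧ Gs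

    -- If `H` is `G`, three distinct vertices exhaust the group and the edge is the group itself;
    -- otherwise a pair gadget covers it.
    two-in-a-group : ∀ {G H} → G ∈ₗ Gs → H ∈ₗ Gs → ∀ {i j k} → G i ≢ G j → G i ≢ H k → G j ≢ H k → Done ⦅ G i , G j , H k ⦆
    two-in-a-group {G} G∈ H∈ {i} {j} {k} i≢j i≢k j≢k with allPairs-lookup {R = Pair ws} pair-sym pairs-covered G∈ H∈
    ... | inj₁ refl = inj₂ (subst (_∈ₗ _) (sym (group-full G i j k (i≢j ∘ cong G) (i≢k ∘ cong G) (j≢k ∘ cong G))) (∈-map⁺ ⟦_⟧ G∈))
    ... | inj₂ GH   = inj₁ (proj₁ (GH i j k (i≢j ∘ cong G)))

    all-done : ∀ {G H K} → G ∈ₗ Gs → H ∈ₗ Gs → K ∈ₗ Gs → ∀ {i j k} → G i ≢ H j → G i ≢ K k → H j ≢ K k → Done ⦅ G i , H j , K k ⦆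
    all-done G∈ H∈ K∈ {i} {j} {k} i≢j i≢k j≢k
      with allTriples-lookup {P = Transversal ws} transversal-swap₁₂ transversal-swap₂₃ transversals-covered G∈ H∈ K∈
    ... | inj₁ refl = two-in-a-group G∈ K∈ i≢j i≢k j≢k
    ... | inj₂ (inj₁ refl) = subst Done (⦅⦆-swap₂₃ _ _ _) (two-in-a-group G∈ H∈ i≢k i≢j (j≢k ∘ sym))
    ... | inj₂ (inj₂ (inj₁ refl)) = subst Done (trans (⦅⦆-swap₂₃ _ _ _) (⦅⦆-swap₁₂ _ _ _))
                                      (two-in-a-group H∈ G∈ j≢k (i≢j ∘ sym) (i≢k ∘ sym))
    ... | inj₂ (inj₂ (inj₂ c)) = inj₁ (c i j k)

pairHexagons-cover : (G H : Group v) → Pair (pairHexagons (G , H)) G H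
pairHexagons-cover G H i j k i≢j =
    covered-label (lookup (G ∷ H ∷ [])) pairGadget 0F 0F 1F i j k (pairGadget-covers 0F 1F i j k (λ ()) i≢j)
  , covered-label (lookup (G ∷ H ∷ [])) pairGadget 1F 1F 0F i j k (pairGadget-covers 1F 0F i j k (λ ()) i≢j)

quadHexagons-cover : (G H K L : Group v) →
  Transversal (quadHexagons (G , H , K , L)) G H K × Transversal (quadHexagons (G , H , K , L)) G H L
quadHexagons-cover G H K L =
    (λ i j k → covered-label (lookup (G ∷ H ∷ K ∷ L ∷ [])) quadGadget 0F 1F 2F i j k (proj₁ (quadGadget-covers i j k)))
  , (λ i j k → covered-label (lookup (G ∷ H ∷ K ∷ L ∷ [])) quadGadget 0F 1F 3F i j k (proj₂ (quadGadget-covers i j k)))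

length-pairHexagons : (GH : Group v × Group v) → length (pairHexagons GH) ≡ 3
length-pairHexagons (G , H) = length-map (label (lookup (G ∷ H ∷ [])) ∘_) pairGadget

length-quadHexagons : (q : Quad (Group v)) → length (quadHexagons q) ≡ 9
length-quadHexagons (G , H , K , L) = length-map (label (lookup (G ∷ H ∷ K ∷ L ∷ [])) ∘_) quadGadget

module _ {v : ℕ} (Gs : List (Group v)) where

  covered-by-pair : ∀ {GH e} → GH ∈ₗ pairs Gs → Covered (pairHexagons GH) e → Covered (hexagons Gs) e
  covered-by-pair GH∈ c = Any.++⁺ˡ (Any.concatMap⁺ pairHexagons (lose GH∈ c))

  covered-by-quad : ∀ {q e} → q ∈ₗ quads Gs → Covered (quadHexagons q) e → Covered (hexagons Gs) e
  covered-by-quad q∈ c = Any.++⁺ʳ (concatMap pairHexagons (pairs Gs)) (Any.concatMap⁺ quadHexagons (lose q∈ c))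

  hexagons-pairs : AllPairs (Pair (hexagons Gs)) Gs
  hexagons-pairs = pairs⇒AllPairs Gs (All.tabulate λ { {G , H} GH∈ i j k i≢j →
    let c , c′ = pairHexagons-cover G H i j k i≢j in covered-by-pair GH∈ c , covered-by-pair GH∈ c′ })

  module _ (≢3 : length Gs % 4 ≢ 3) where

    hexagons-transversals : AllTriples (Transversal (hexagons Gs)) Gs
    hexagons-transversals = quads⇒AllTriples {P = Transversal (hexagons Gs)}
      (transversal-swap₁₂ {ws = hexagons Gs}) (transversal-swap₂₃ {ws = hexagons Gs}) Gs ≢3
      λ {G} {H} {K} {L} q∈ → let c , c′ = quadHexagons-cover G H K L in
        (λ i j k → covered-by-quad q∈ (c i j k)) , (λ i j k → covered-by-quad q∈ (c′ i j k))

    -- Three hexagons per pair of groups give 18 edges. Nine per quad give 54, that is 27 for each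
    -- of its two triples of groups. The total matches `c₃-triple`.
    length-hexagons : 6 * length (hexagons Gs) + length Gs ≡ c₃ (length Gs * 3)
    length-hexagons = begin
      6 * length (hexagons Gs) + m             ≡⟨ cong (λ l → 6 * l + m) (length-++ (concatMap pairHexagons (pairs Gs))) ⟩
      6 * (length (concatMap pairHexagons (pairs Gs)) + length (concatMap quadHexagons (quads Gs))) + m
                                               ≡⟨ cong (λ l → 6 * l + m) (cong₂ _+_
                                                    (length-concatMap-const pairHexagons length-pairHexagons (pairs Gs))
                                                    (length-concatMap-const quadHexagons length-quadHexagons (quads Gs))) ⟩
      6 * (3 * length (pairs Gs) + 9 * q) + m  ≡⟨ cong (λ l → 6 * (3 * l + 9 * q) + m) (length-pairs Gs) ⟩
      6 * (3 * c₂ m + 9 * q) + m               ≡⟨ eq (c₂ m) q m ⟩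
      27 * (2 * q) + 18 * c₂ m + m             ≡⟨ cong (λ c → 27 * c + 18 * c₂ m + m) (length-quads Gs ≢3) ⟩
      27 * c₃ m + 18 * c₂ m + m                ≡⟨ c₃-triple m ⟨
      c₃ (m * 3)                               ∎
      where
      open ≡-Reasoning
      m = length Gs
      q = length (quads Gs)
      eq : ∀ c q m → 6 * (3 * c + 9 * q) + m ≡ 27 * (2 * q) + 18 * c + m
      eq = solve-∀

-- Constructing the decomposition from a 1-factor

toGroups : {ts : List (Subset v)} → All (λ t → ∣ t ∣ ≡ 3) ts → ∃[ Gs ] map ⟦_⟧ Gs ≡ ts
toGroups [] = [] , refl
toGroups {ts = t ∷ _} (∣t∣≡3 ∷ ∣ts∣≡3)
  with x , y , z , refl , _ ← ∣p∣≡3⇒p≡⦅⦆ t ∣t∣≡3 | Gs , refl ← toGroups ∣ts∣≡3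
  = lookup (x ∷ y ∷ z ∷ []) ∷ Gs , refl

∈-⟦⟧⁻ : {G : Group v} {x : Fin v} → x ∈ ⟦ G ⟧ → ∃[ i ] x ≡ G i
∈-⟦⟧⁻ x∈ with ∈-⦅⦆⁻ x∈
... | inj₁ eq        = 0F , eq
... | inj₂ (inj₁ eq) = 1F , eq
... | inj₂ (inj₂ eq) = 2F , eq

module _ (m : ℕ) (I : OneFactor (m * 3)) where

  open OneFactor I

  length-triples : length triples ≡ m
  length-triples = trans size (m*n/n≡m m 3)

  triples-unique : Unique triples
  triples-unique = distinct uniform disjoint
    where
    distinct : {ts : List (Subset (m * 3))} → All (λ t → ∣ t ∣ ≡ 3) ts → AllPairs (λ s t → Empty (s ∩ t)) ts → Unique ts
    distinct [] [] = []
    distinct (∣t∣≡3 ∷ ∣ts∣≡3) (t# ∷ ts#) = All.map (λ { t∩t∅ refl → nonempty ∣t∣≡3 t∩t∅ }) t# ∷ distinct ∣ts∣≡3 ts#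
      where
      nonempty : {t : Subset (m * 3)} → ∣ t ∣ ≡ 3 → ¬ Empty (t ∩ t)
      nonempty {t} ∣t∣≡3 t∩t∅ with x , y , z , refl , _ ← ∣p∣≡3⇒p≡⦅⦆ t ∣t∣≡3 =
        t∩t∅ (x , x∈p∩q⁺ (∈-⦅⦆⁺ (inj₁ refl) , ∈-⦅⦆⁺ (inj₁ refl)))

  -- Counting turns a covering into a partition: the listed edges are a permutation of all triples.
  module _ (ws : List (Hexagon (m * 3))) (length-ws : 6 * length ws + m ≡ c₃ (m * 3))
    (covered : ∀ e → ∣ e ∣ ≡ 3 → Covered ws e ⊎ e ∈ₗ triples) where

    choose↭ : choose (m * 3) 3 ↭ edgeLists ws ++ triples
    choose↭ = unique-⊆-length≡⇒↭ (choose-unique (m * 3) 3)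
      (λ {e} e∈ → [ ∈-++⁺ˡ ∘ ∈-edgeLists⁺ , ∈-++⁺ʳ _ ]′ (covered e (choose-sound (m * 3) 3 e∈)))
      (begin
        length (choose (m * 3) 3)               ≡⟨ length-choose₃ (m * 3) ⟩
        c₃ (m * 3)                              ≡⟨ length-ws ⟨
        6 * length ws + m                       ≡⟨ cong₂ _+_ (length-edgeLists ws) length-triples ⟨
        length (edgeLists ws) + length triples  ≡⟨ length-++ (edgeLists ws) ⟨
        length (edgeLists ws ++ triples)        ∎)
      where open ≡-Reasoning

    -- By `choose↭` the list `edgeLists ws ++ triples` has no repetitions. Hence the hexagons are
    -- cycles, they are pairwise edge-disjoint, and they avoid the triples of the 1-factor.
    covering⇒decomposition : Decomposition 6 (K⁽³⁾ (m * 3) - I)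
    covering⇒decomposition
      with L! , _ , L#triples ← unique-++⁻ (edgeLists ws) (↭ₛ.Unique-resp-↭ (setoid _) (↭⇒↭ₛ choose↭) (choose-unique (m * 3) 3))
      with Cs , Cs≡ , Cs# ← toCycles ws L! (λ e∈ → choose-sound (m * 3) 3 (∈-resp-↭ (↭-sym choose↭) (∈-++⁺ˡ e∈)))
      = record
      { cycles   = Cs
      ; within   = All.tabulate λ { C∈Cs {e} C∋e →
          let e∈L = ∈-edgeLists⁺ (subst (λ ws → Covered ws e) Cs≡ (Any.map⁺ (lose C∈Cs C∋e)))
          in choose-sound (m * 3) 3 (∈-resp-↭ (↭-sym choose↭) (∈-++⁺ˡ e∈L)) , λ e∈triples → L#triples (e∈L , e∈triples) }
      ; disjoint = Cs#
      ; covers   = λ e (∣e∣≡3 , e∉triples) → Any.map⁻ (subst (λ ws → Covered ws e) (sym Cs≡)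
          ([ id , (λ e∈ → contradiction e∈ e∉triples) ]′ (covered e ∣e∣≡3)))
      }

  group-of : ∀ {Gs} → map ⟦_⟧ Gs ≡ triples → ∀ x → ∃₂ λ G i → G ∈ₗ Gs × x ≡ G i
  group-of Gs≡ x with G , G∈ , x∈ ← find (Any.map⁻ (subst (Any (x ∈_)) (sym Gs≡) (covers x)))
                 with i , eq ← ∈-⟦⟧⁻ {G = G} x∈ = G , i , G∈ , eq

  cover : ∀ {Gs ws} → map ⟦_⟧ Gs ≡ triples → AllPairs (Pair ws) Gs → AllTriples (Transversal ws) Gs →
    ∀ e → ∣ e ∣ ≡ 3 → Covered ws e ⊎ e ∈ₗ triples
  cover {ws = ws} Gs≡ ps ts e ∣e∣≡3
    with x , y , z , refl , x≢y , x≢z , y≢z ← ∣p∣≡3⇒p≡⦅⦆ e ∣e∣≡3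
    with _ , _ , G∈ , refl ← group-of Gs≡ x
    with _ , _ , H∈ , refl ← group-of Gs≡ y
    with _ , _ , K∈ , refl ← group-of Gs≡ z
    = subst (λ ts → Covered ws e ⊎ e ∈ₗ ts) Gs≡ (all-done ps ts G∈ H∈ K∈ x≢y x≢z y≢z)

  decompose : m % 4 ≢ 3 → Decomposition 6 (K⁽³⁾ (m * 3) - I)
  decompose ≢3 with Gs , Gs≡ ← toGroups uniform =
    covering⇒decomposition (hexagons Gs)
      (subst (λ l → 6 * length (hexagons Gs) + l ≡ c₃ (l * 3)) length-Gs (length-hexagons Gs Gs≢3))
      (cover Gs≡ (hexagons-pairs Gs) (hexagons-transversals Gs Gs≢3))
    where
    length-Gs : length Gs ≡ m
    length-Gs = trans (sym (length-map ⟦_⟧ Gs)) (trans (cong length Gs≡) length-triples)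

    Gs≢3 : length Gs % 4 ≢ 3
    Gs≢3 = subst (λ l → l % 4 ≢ 3) (sym length-Gs) ≢3

  -- Necessity: parity of the number of edges

  module _ (D : Decomposition 6 (K⁽³⁾ (m * 3) - I)) where

    open Decomposition D renaming (disjoint to cycles-disjoint; covers to cycles-cover)

    L : List (Subset (m * 3))
    L = edgeLists (map Cycle.vertex cycles)

    L⇒cycles : ∀ {e} → e ∈ₗ L → Any (λ C → edges C e) cycles
    L⇒cycles = Any.map⁻ ∘ ∈-edgeLists⁻ (map Cycle.vertex cycles)

    cycles⇒H : ∀ {e} → Any (λ C → edges C e) cycles → (K⁽³⁾ (m * 3) - I) e
    cycles⇒H C∋e with C , C∈ , e∈ ← find C∋e = All.lookup within C∈ e∈

    L-unique : Unique L
    L-unique = Unique.concat⁺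
      (All.map⁺ (All.map⁺ (All.tabulate λ {C} _ → edgeList-unique (Cycle.distinct C))))
      (AllPairs.map⁺ (AllPairs.map⁺ (AllPairs.map (λ {C} {D} → disjoint-lists {C} {D}) cycles-disjoint)))
      where
      disjoint-lists : ∀ {C D : Cycle 6 (m * 3)} → (∀ {e} → ¬ (edges C e × edges D e)) → Disjoint (edgeList (Cycle.vertex C)) (edgeList (Cycle.vertex D))
      disjoint-lists {C} {D} C#D (e∈C , e∈D) = C#D (∈-edgeList⁻ (Cycle.vertex C) e∈C , ∈-edgeList⁻ (Cycle.vertex D) e∈D)

    L++triples-unique : Unique (L ++ triples)
    L++triples-unique = Unique.++⁺ L-unique triples-unique λ (e∈L , e∈triples) → proj₂ (cycles⇒H (L⇒cycles e∈L)) e∈triples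

    L++triples⊆choose : ∀ {e} → e ∈ₗ L ++ triples → e ∈ₗ choose (m * 3) 3
    L++triples⊆choose {e} e∈ = subst (λ k → e ∈ₗ choose (m * 3) k)
      ([ proj₁ ∘ cycles⇒H ∘ L⇒cycles , All.lookup uniform ]′ (∈-++⁻ L e∈)) (choose-complete e)

    choose⊆L++triples : ∀ {e} → e ∈ₗ choose (m * 3) 3 → e ∈ₗ L ++ triples
    choose⊆L++triples {e} e∈ with Any.any? (e ≟ˢ_) triples
    ... | yes e∈triples = ∈-++⁺ʳ L e∈triples
    ... | no e∉triples  = ∈-++⁺ˡ (∈-edgeLists⁺ (Any.map⁺ (cycles-cover e (choose-sound (m * 3) 3 e∈ , e∉triples))))

    -- `L ++ triples` and `choose (m * 3) 3` are duplicate-free with the same members, so each is at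
    -- most as long as the other.
    edge-count : 6 * length cycles + m ≡ 27 * c₃ m + 18 * c₂ m + m
    edge-count = begin
      6 * length cycles + m                         ≡⟨ cong₂ (λ l t → 6 * l + t) (length-map Cycle.vertex cycles) length-triples ⟨
      6 * length (map Cycle.vertex cycles) + length triples  ≡⟨ cong (_+ length triples) (length-edgeLists (map Cycle.vertex cycles)) ⟨
      length L + length triples                     ≡⟨ length-++ L ⟨
      length (L ++ triples)                         ≡⟨ ≤-antisym (unique-⊆⇒length≤ L++triples-unique L++triples⊆choose)
                                                                 (unique-⊆⇒length≤ (choose-unique (m * 3) 3) choose⊆L++triples) ⟩
      length (choose (m * 3) 3)                     ≡⟨ length-choose₃ (m * 3) ⟩
      c₃ (m * 3)                                    ≡⟨ c₃-triple m ⟩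
      27 * c₃ m + 18 * c₂ m + m                     ∎
      where open ≡-Reasoning

    m%4≢3 : m % 4 ≢ 3
    m%4≢3 m%4≡3 with h , c₃-odd′ ← c₃-odd (m / 4) =
      -- The 13 comes from 27(2h + 1) = 2(27h + 13) + 1.
      even≢odd (3 * length cycles) (13 + 27 * h + 9 * c₂ m) (begin
        2 * (3 * length cycles)              ≡⟨ eq₁ (length cycles) ⟩
        6 * length cycles                    ≡⟨ +-cancelʳ-≡ m _ _ edge-count ⟩
        27 * c₃ m + 18 * c₂ m                ≡⟨ cong (λ c → 27 * c + 18 * c₂ m) (trans (cong c₃ m≡) c₃-odd′) ⟩
        27 * suc (2 * h) + 18 * c₂ m         ≡⟨ eq₂ h (c₂ m) ⟩
        suc (2 * (13 + 27 * h + 9 * c₂ m))   ∎)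
      where
      open ≡-Reasoning
      m≡ : m ≡ 3 + m / 4 * 4
      m≡ = trans (m≡m%n+[m/n]*n m 4) (cong (_+ m / 4 * 4) m%4≡3)
      eq₁ : ∀ n → 2 * (3 * n) ≡ 6 * n
      eq₁ = solve-∀
      eq₂ : ∀ h c → 27 * suc (2 * h) + 18 * c ≡ suc (2 * (13 + 27 * h + 9 * c))
      eq₂ = solve-∀

-- Because `m * 3 % 12` equals `m % 4 * 3`, only the four remainders modulo 4 have to be inspected.
residues : ∀ m → m % 4 ≢ 3 ⇔ (m * 3 % 12 ≡ 0 ⊎ m * 3 % 12 ≡ 3 ⊎ m * 3 % 12 ≡ 6)
residues m rewrite sym (m%n*o≡m*o%[n*o] m 4 3) = mk⇔ (to (m % 4) (m%n<n m 4)) (from (m % 4))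
  where
  to : ∀ r → r < 4 → r ≢ 3 → r * 3 ≡ 0 ⊎ r * 3 ≡ 3 ⊎ r * 3 ≡ 6
  to 0 _ _  = inj₁ refl
  to 1 _ _  = inj₂ (inj₁ refl)
  to 2 _ _  = inj₂ (inj₂ refl)
  to 3 _ ≢3 = contradiction refl ≢3
  to (suc (suc (suc (suc _)))) (s≤s (s≤s (s≤s (s≤s ())))) _
  from : ∀ r → r * 3 ≡ 0 ⊎ r * 3 ≡ 3 ⊎ r * 3 ≡ 6 → r ≢ 3
  from _ (inj₁ ())        refl
  from _ (inj₂ (inj₁ ())) refl
  from _ (inj₂ (inj₂ ())) refl

theorem2 : (v : ℕ) → 4 ≤ v → 3 ∣ v → (I : OneFactor v) →
    Decomposition 6 (K⁽³⁾ v - I) ⇔ (v % 12 ≡ 0 ⊎ v % 12 ≡ 3 ⊎ v % 12 ≡ 6)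
theorem2 _ _ (divides m refl) I = mk⇔ (to ∘ m%4≢3 m I) (decompose m I ∘ from)
  where open Equivalence (residues m)
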